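{- Let $G$ be a graph of local boxicity at most $2$ and let $r=\omega(G)$ be its clique number. Then $\chi(G)\le 320\cdot r^3\log(2r)$.
   Context: All graphs are finite and simple; $\log$ is the binary logarithm; $\chi$ is the chromatic number and $\omega$ the clique number. A real interval is either a bounded interval of $\mathbb{R}$ or $\mathbb{R}$ itself. For an integer $d'\ge 1$, a $d'$-box is a Cartesian product $I_1\times\cdots\times I_{d'}$ of real intervals; it is local in dimension $i$ if $I_i$ is bounded. A $d$-local box in dimension $d'\ge d$ is a $d'$-box that is local in at most $d$ dimensions. The local boxicity $\mathrm{lbox}(G)$ of a graph $G$ is the minimum integer $d$ such that, for some $d'$, there are $d$-local boxes $(B_v)_{v\in V(G)}$ in dimension $d'$ such that two distinct vertices $u,v$ are adjacent in $G$ if and only if $B_u\cap B_v\neq\emptyset$.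
   Formalization: The bounded intervals that form the boxes have rational instead of real endpoints (and the boxes meet in rational points); for a finite graph real endpoints can be replaced by rational ones in the same order. -}

module Defs where

open import Data.Nat using (ℕ; zero; suc; _+_; _*_; _^_; _≤_)
open import Data.Fin using (Fin) renaming (zero to fzero; suc to fsuc)
open import Data.Unit using (⊤)
open import Data.Bool using (Bool; true; false)
open import Data.Rational using (ℚ) renaming (_<_ to _<ℚ_; _≤_ to _≤ℚ_)
open import Data.Product using (Σ; _×_; ∃)
open import Data.Sum using (_⊎_)
open import Data.Empty using (⊥)
open import Relation.Binary.PropositionalEquality using (_≡_)
open import Relation.Nullary using (¬_)
open import Function.Definitions using (Injective)
open import Function.Bundles using (_⇔_)

record Graph : Set₁ where
  field
    n     : ℕ
    Adj   : Fin n → Fin n → Set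
    sym   : ∀ {u v} → Adj u v → Adj v u
    irrefl : ∀ {u} → ¬ Adj u u

open Graph public

-- Real intervals (endpoints taken in ℚ).
-- A bounded interval has endpoints lo, hi, each open or closed (true = closed);
-- 'whole' is the whole line.
data Interval : Set where
  bounded : (lo : ℚ) (loClosed : Bool) (hi : ℚ) (hiClosed : Bool) → Interval
  whole   : Interval

LowerOK : ℚ → Bool → ℚ → Set
LowerOK lo true  x = lo ≤ℚ x
LowerOK lo false x = lo <ℚ x

UpperOK : ℚ → Bool → ℚ → Set
UpperOK hi true  x = x ≤ℚ hi
UpperOK hi false x = x <ℚ hi

_∈I_ : ℚ → Interval → Set
x ∈I bounded lo lc hi hc = LowerOK lo lc x × UpperOK hi hc x
x ∈I whole = ⊤

Box : ℕ → Set
Box d' = Fin d' → Interval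

isBounded : Interval → Bool
isBounded (bounded _ _ _ _) = true
isBounded whole = false

countTrue : ∀ {k} → (Fin k → Bool) → ℕ
countTrue {zero}  f = 0
countTrue {suc k} f with f fzero
... | true  = suc (countTrue (λ i → f (fsuc i)))
... | false = countTrue (λ i → f (fsuc i))

numLocal : ∀ {d'} → Box d' → ℕ
numLocal B = countTrue (λ i → isBounded (B i))

BoxesIntersect : ∀ {d'} → Box d' → Box d' → Set
BoxesIntersect {d'} B C = Σ (Fin d' → ℚ) λ x → ∀ i → (x i ∈I B i) × (x i ∈I C i)

LocalBoxRep : (G : Graph) (d d' : ℕ) → Set
LocalBoxRep G d d' =
  Σ (Fin (n G) → Box d') λ B →
    (∀ v → numLocal (B v) ≤ d) ×
    (∀ u v → ¬ u ≡ v → (Adj G u v ⇔ BoxesIntersect (B u) (B v)))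

-- lbox(G) ≤ d  (lbox is a minimum, so this means some d₀ ≤ d works)
LboxAtMost : Graph → ℕ → Set
LboxAtMost G d = Σ ℕ λ d₀ → d₀ ≤ d × Σ ℕ λ d' → 1 ≤ d' × d₀ ≤ d' × LocalBoxRep G d₀ d'

IsClique : (G : Graph) (k : ℕ) → (Fin k → Fin (n G)) → Set
IsClique G k f = Injective _≡_ _≡_ f × (∀ i j → ¬ i ≡ j → Adj G (f i) (f j))

CliqueNumber : Graph → ℕ → Set
CliqueNumber G r =
  (Σ (Fin r → Fin (n G)) λ f → IsClique G r f) ×
  (∀ k (f : Fin k → Fin (n G)) → IsClique G k f → k ≤ r)

ProperColoring : (G : Graph) (k : ℕ) → (Fin (n G) → Fin k) → Set
ProperColoring G k c = ∀ u v → Adj G u v → ¬ c u ≡ c v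

ChiBound : Graph → ℕ → Set
ChiBound G r = Σ ℕ λ k → Σ (Fin (n G) → Fin k) λ c →
  ProperColoring G k c × (2 ^ k ≤ (2 * r) ^ (320 * (r * r * r)))

{-# OPTIONS --safe #-}

-- Vertices whose boxes have no common local dimension are adjacent, so a maximal family of vertices
-- with pairwise disjoint sets of local dimensions has at most r members, and 2r dimensions meet every
-- such set. This splits the graph into 2r stars: in a star all boxes have the dimension p in common,
-- and v has one further local dimension q(v).
--
-- Inside a star, order the boxes with the same q by crossing: u ≺ v if u is contained in v along p and
-- contains v along q. Comparable boxes intersect. Let h(v) be the length of a longest chain above v,
-- and call (q(v), h(v)) the class of v. Over any point of p at most r classes are present, because the
-- chain above the highest box for each q provides a clique of that size. Sweeping along p, r colours
-- hence suffice to tell intersecting boxes of different classes apart. No two boxes of the same class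
-- cross, so if two of them intersect then one contains one of three fixed corners of the other. A point
-- lies in at most r boxes of a class, so this is an orientation with outdegrees at most 3r, and 6r + 1
-- colours suffice (Asplund and Grünbaum). Altogether 2r · r · (6r + 1) ≤ 320 r³ colours are used.
module Submission where

open import Defs hiding (sym)
open import Data.Bool using (Bool; true; false; if_then_else_)
open import Data.Fin using (Fin; combine; inject≤; toℕ) renaming (zero to fzero; suc to fsuc)
import Data.Fin.Properties as Fin
open import Data.List using (List; []; _∷_; _++_; length; map; filter; lookup; allFin)
open import Data.List.Extrema using (argmax; argmax-sel; f[⊥]≤f[argmax]; f[xs]≤f[argmax])
open import Data.List.Membership.Propositional using (_∈_; _∉_; find; lose)
open import Data.List.Membership.Propositional.Properties
  using (∈-∃++; ∈-lookup; ∈-map⁺; ∈-++⁺ˡ; ∈-++⁺ʳ; ∈-filter⁺; ∈-filter⁻; ∈-allFin)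
open import Data.List.Properties using (length-++; length-map)
open import Data.List.Relation.Binary.Permutation.Propositional using (_↭_; ↭-reflexive; ↭-sym; ↭-trans)
open import Data.List.Relation.Binary.Permutation.Propositional.Properties
  using (shift; filter-↭; ↭-length; ∈-resp-↭)
open import Data.List.Relation.Unary.All as All using ()
open import Data.List.Relation.Unary.All.Properties using (¬Any⇒All¬)
open import Data.List.Relation.Unary.AllPairs using ([]; _∷_)
open import Data.List.Relation.Unary.Any using (Any; here; there; any?; index)
open import Data.List.Relation.Unary.Any.Properties using (lookup-index)
open import Data.List.Relation.Unary.Unique.Propositional using (Unique)
open import Data.List.Relation.Unary.Unique.Propositional.Properties using (allFin⁺; filter⁺)
open import Data.Nat using (ℕ; zero; suc; _+_; _*_; _^_; _≤_; _<_; z≤n; s≤s)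
open import Data.Nat.ListAction using (sum)
import Data.Nat.Properties as ℕ
open import Algebra.Properties.CommutativeSemigroup ℕ.+-commutativeSemigroup using (x∙yz≈y∙xz)
open import Data.Nat.Solver using (module +-*-Solver)
open import Data.Product using (Σ; ∃; ∃-syntax; ∃₂; _×_; _,_; proj₁; proj₂)
open import Data.Product.Properties using (≡-dec)
open import Data.Product.Relation.Binary.Lex.NonStrict using (×-decTotalOrder)
open import Data.Rational as ℚ using (ℚ; 0ℚ; 1ℚ)
import Data.Rational.Properties as ℚ
open import Data.Sum as Sum using (_⊎_; inj₁; inj₂; [_,_]′)
open import Data.Unit using (⊤; tt)
open import Function using (_∘_; Injective)
open import Function.Bundles using (Equivalence; _⇔_)
open import Level using (0ℓ)
open import Relation.Binary using (Decidable; DecidableEquality; DecTotalOrder; tri<; tri≈; tri>)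
open import Relation.Binary.PropositionalEquality using (_≡_; _≢_; refl; sym; trans; cong; cong₂; subst)
open import Relation.Nullary using (¬_; Dec; yes; no; does; contradiction; ¬?)
open import Relation.Nullary.Decidable using (_×-dec_; _⊎-dec_; dec-true)
open import Relation.Unary using () renaming (Decidable to Decidable₁)

-- Finite search, lists, pigeonhole and averaging.

greatest : {P : ℕ → Set} → Decidable₁ P → P 0 → ∀ N → (∀ k → P k → k ≤ N) →
           ∃[ h ] P h × (∀ k → P k → k ≤ h)
greatest P? p0 zero    bound = 0 , p0 , bound
greatest P? p0 (suc N) bound with P? (suc N)
... | yes p = suc N , p , bound
... | no ¬p = greatest P? p0 N λ k pk → lower k pk (ℕ.m≤n⇒m<n∨m≡n (bound k pk))
  where
  lower : ∀ k → _ → k < suc N ⊎ k ≡ suc N → k ≤ N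
  lower k pk (inj₁ k<1+N) = ℕ.≤-pred k<1+N
  lower k pk (inj₂ refl)  = contradiction pk ¬p

lookup-injective : {A : Set} {xs : List A} → Unique xs → Injective _≡_ _≡_ (lookup xs)
lookup-injective (_ ∷ _) {fzero}  {fzero}  _  = refl
lookup-injective (x∉ ∷ _) {fzero} {fsuc j} eq = contradiction eq (All.lookup x∉ (∈-lookup j))
lookup-injective (x∉ ∷ _) {fsuc i} {fzero} eq = contradiction (sym eq) (All.lookup x∉ (∈-lookup i))
lookup-injective (_ ∷ u) {fsuc i} {fsuc j} eq = cong fsuc (lookup-injective u eq)

∈⇒↭ : {A : Set} {x : A} {xs : List A} → x ∈ xs → ∃[ ys ] xs ↭ x ∷ ys
∈⇒↭ {x = x} x∈xs with as , bs , eq ← ∈-∃++ x∈xs =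
  as ++ bs , ↭-trans (↭-reflexive eq) (shift x as bs)

∈-tail : {A : Set} {v z : A} {ys : List A} → z ∈ v ∷ ys → z ≢ v → z ∈ ys
∈-tail (here eq)  z≢v = contradiction eq z≢v
∈-tail (there z∈) _   = z∈

-- Were every colour in `cs`, `index` would inject `Fin K` into the positions of `cs`.
fresh : ∀ {K} (cs : List (Fin K)) → length cs < K → ∃[ c ] c ∉ cs
fresh {K} cs few =
  Fin.¬∀⟶∃¬ K (_∈ cs) (λ c → any? (c Fin.≟_) cs) λ all → ℕ.1+n≰n (ℕ.≤-trans few (surjective⇒≤ all))
  where
  surjective⇒≤ : (∀ c → c ∈ cs) → K ≤ length cs
  surjective⇒≤ all = Fin.injective⇒≤ {f = index ∘ all} λ {c} {d} eq →
    trans (lookup-index (all c)) (trans (cong (lookup cs) eq) (sym (lookup-index (all d))))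

-- Averaging: a head of value above `k` leaves a tail whose average is still at most `k`.
∃-small : {A : Set} (f : A → ℕ) (k : ℕ) (x : A) (xs : List A) →
          sum (map f (x ∷ xs)) ≤ length (x ∷ xs) * k → ∃[ u ] u ∈ x ∷ xs × f u ≤ k
∃-small f k x xs le with f x ℕ.≤? k
... | yes fx≤k = x , here refl , fx≤k
∃-small f k x [] le | no fx≰k =
  contradiction (ℕ.≤-trans (ℕ.m≤m+n (f x) 0) (ℕ.≤-trans le (ℕ.≤-reflexive (ℕ.+-identityʳ k)))) fx≰k
∃-small f k x (y ∷ ys) le | no fx≰k =
  let le′ = ℕ.≤-trans (ℕ.+-monoˡ-≤ _ (ℕ.<⇒≤ (ℕ.≰⇒> fx≰k))) le
      u , u∈ , fu≤k = ∃-small f k y ys (ℕ.+-cancelˡ-≤ k _ _ le′)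
  in u , there u∈ , fu≤k

sum-map-≤ : {A : Set} (f : A → ℕ) (k : ℕ) → (∀ x → f x ≤ k) →
            ∀ xs → sum (map f xs) ≤ length xs * k
sum-map-≤ f k f≤k []       = z≤n
sum-map-≤ f k f≤k (x ∷ xs) = ℕ.+-mono-≤ (f≤k x) (sum-map-≤ f k f≤k xs)

-- Degrees in a finite relation.

module _ {A : Set} {R : A → A → Set} (R? : Decidable R) where

  outdegree indegree : List A → A → ℕ
  outdegree xs u = length (filter (R? u) xs)
  indegree  xs v = length (filter (λ u → R? u v) xs)

  indegree-∷ : ∀ x xs ys →
    sum (map (indegree (x ∷ xs)) ys) ≡ outdegree ys x + sum (map (indegree xs) ys)
  indegree-∷ x xs []       = refl
  indegree-∷ x xs (y ∷ ys) with ih ← indegree-∷ x xs ys | does (R? x y)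
  ... | false =
    trans (cong (indegree xs y +_) ih) (x∙yz≈y∙xz (indegree xs y) (outdegree ys x) _)
  ... | true  =
    cong suc (trans (cong (indegree xs y +_) ih) (x∙yz≈y∙xz (indegree xs y) (outdegree ys x) _))

  double-counting : ∀ xs ys → sum (map (outdegree ys) xs) ≡ sum (map (indegree xs) ys)
  double-counting []       []       = refl
  double-counting []       (y ∷ ys) = double-counting [] ys
  double-counting (x ∷ xs) ys       =
    trans (cong (outdegree ys x +_) (double-counting xs ys)) (sym (indegree-∷ x xs ys))

-- Greedy colouring under pairwise constraints.

module Colouring {A : Set} (_≟_ : DecidableEquality A) {X : Set} where

  update : (A → X) → A → X → A → X
  update c v x w = if does (w ≟ v) then x else c w

  -- A common form for both colourings below: the constraint on two colours may depend on the two
  -- vertices, as in `Separates` and `Classifies`.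
  ColouringOf : (A → A → X → X → Set) → List A → (A → X) → Set
  ColouringOf Φ xs c = ∀ {u w} → u ∈ xs → w ∈ xs → Φ u w (c u) (c w)

  -- `v` is the vertex to be coloured last. It may sit anywhere in the list, hence the permutation.
  Extendable : (A → A → X → X → Set) → (List A → Set) → List A → Set
  Extendable Φ Inv xs = ∃₂ λ v ys → xs ↭ v ∷ ys × Inv ys ×
    (∀ c → ColouringOf Φ ys c → ∃[ x ] (∀ {w} → w ∈ ys → Φ v w x (c w)))

  module _ (Φ : A → A → X → X → Set)
           (Φ-sym  : ∀ {u w x y} → Φ u w x y → Φ w u y x)
           (Φ-refl : ∀ {v x} → Φ v v x x) where

    -- `v` may occur again in `ys`. Since `update` recolours every occurrence, the cases are split
    -- by equality with `v` rather than by position.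
    update-colouring : ∀ {v ys c x} → ColouringOf Φ ys c → (∀ {w} → w ∈ ys → Φ v w x (c w)) →
                       ColouringOf Φ (v ∷ ys) (update c v x)
    update-colouring {v} {ys} good ext {u} {w} u∈ w∈ with u ≟ v | w ≟ v
    ... | yes refl | yes refl = Φ-refl
    ... | yes refl | no  w≢v  = ext (∈-tail w∈ w≢v)
    ... | no  u≢v  | yes refl = Φ-sym (ext (∈-tail u∈ u≢v))
    ... | no  u≢v  | no  w≢v  = good (∈-tail u∈ u≢v) (∈-tail w∈ w≢v)

    greedy : (Inv : List A → Set) → (∀ x xs → Inv (x ∷ xs) → Extendable Φ Inv (x ∷ xs)) →
             (A → X) → ∀ xs → Inv xs → ∃ (ColouringOf Φ xs)
    greedy Inv step c₀ xs = go (length xs) xs refl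
      where
      -- The recursion is on the length because `ys` need not be the tail of the list.
      go : ∀ n xs → length xs ≡ n → Inv xs → ∃ (ColouringOf Φ xs)
      go _       []       _  _   = c₀ , λ ()
      go (suc n) (x ∷ xs) eq inv with v , ys , perm , inv′ , extend ← step x xs inv
        with c , good ← go n ys (ℕ.suc-injective (trans (sym (↭-length perm)) eq)) inv′
        with y , ext ← extend c good =
        update c v y ,
        λ u∈ w∈ → update-colouring {c = c} good ext (∈-resp-↭ perm u∈) (∈-resp-↭ perm w∈)

-- Colouring relations of bounded outdegree.

module _ {A : Set} (_≟_ : DecidableEquality A) {R : A → A → Set} (R? : Decidable R) (k : ℕ) where

  open Colouring _≟_ {Fin (suc (k + k))}

  -- The premise `u ≢ v` allows loops in `R`; the relation `Corner`, to which this is applied, has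
  -- them.
  Separates : A → A → Fin (suc (k + k)) → Fin (suc (k + k)) → Set
  Separates u v x y = u ≢ v → R u v ⊎ R v u → x ≢ y

  abstract
    -- A list with all outdegrees at most k contains a vertex of indegree at most k.
    bounded-outdegree-colouring : ∀ xs → (∀ u → outdegree R? xs u ≤ k) → ∃ (ColouringOf Separates xs)
    bounded-outdegree-colouring =
      greedy Separates
        (λ sep w≢u r eq → sep (w≢u ∘ sym) (Sum.swap r) (sym eq))
        (λ v≢v _ _ → v≢v refl)
        (λ xs → ∀ u → outdegree R? xs u ≤ k)
        step
        (λ _ → fzero)
      where
      step : ∀ x xs → (∀ u → outdegree R? (x ∷ xs) u ≤ k) →
             Extendable Separates (λ xs → ∀ u → outdegree R? xs u ≤ k) (x ∷ xs)
      step x xs out≤k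
        with v , v∈ , in≤k ← ∃-small (indegree R? (x ∷ xs)) k x xs
               (ℕ.≤-trans (ℕ.≤-reflexive (sym (double-counting R? (x ∷ xs) (x ∷ xs))))
                        (sum-map-≤ _ k out≤k (x ∷ xs)))
        with ys , perm ← ∈⇒↭ v∈ = v , ys , perm , (λ u → shrink (R? u) (out≤k u)) , extend
        where
        shrink : {P : A → Set} (P? : Decidable₁ P) →
                 length (filter P? (x ∷ xs)) ≤ k → length (filter P? ys) ≤ k
        shrink P? le = ℕ.≤-trans (drop-head ys)
          (ℕ.≤-trans (ℕ.≤-reflexive (sym (↭-length (filter-↭ P? perm)))) le)
          where
          drop-head : ∀ ys → length (filter P? ys) ≤ length (filter P? (v ∷ ys))
          drop-head ys with does (P? v)
          ... | true  = ℕ.n≤1+n _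
          ... | false = ℕ.≤-refl
        extend : ∀ c → ColouringOf Separates ys c → ∃[ γ ] (∀ {w} → w ∈ ys → Separates v w γ (c w))
        extend c _ = let γ , γ∉ = fresh (map c nbrs) few in
          γ , λ w∈ _ r γ≡cw → γ∉ (subst (_∈ map c nbrs) (sym γ≡cw) (∈-map⁺ c (nbr w∈ r)))
          where
          nbrs : List A
          nbrs = filter (R? v) ys ++ filter (λ u → R? u v) ys
          -- At most `k` out-neighbours and `k` in-neighbours of `v` exclude at most 2k of the 2k +
          -- 1 colours.
          few : length (map c nbrs) < suc (k + k)
          few = s≤s (ℕ.≤-trans (ℕ.≤-reflexive (trans (length-map c nbrs) (length-++ (filter (R? v) ys))))
                             (ℕ.+-mono-≤ (shrink (R? v) (out≤k v)) (shrink (λ u → R? u v) in≤k)))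
          nbr : ∀ {w} → w ∈ ys → R v w ⊎ R w v → w ∈ nbrs
          nbr w∈ (inj₁ r) = ∈-++⁺ˡ (∈-filter⁺ (R? v) w∈ r)
          nbr w∈ (inj₂ r) = ∈-++⁺ʳ _ (∈-filter⁺ (λ u → R? u v) w∈ r)

-- Sweeping intervals that lie on several separate lines.

module Sweep
  (O : DecTotalOrder 0ℓ 0ℓ 0ℓ)
  {A : Set} (_≟_ : DecidableEquality A)
  {S K : Set} (_≟S_ : DecidableEquality S) (_≟K_ : DecidableEquality K)
  (line : A → S) (class : A → K) (class⇒line : ∀ {u v} → class u ≡ class v → line u ≡ line v)
  (left right : A → DecTotalOrder.Carrier O)
  (left≤right : ∀ v → DecTotalOrder._≤_ O (left v) (right v))
  where

  open DecTotalOrder O using (totalOrder) renaming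
    (_≤_ to _≼_; _≤?_ to _≼?_; refl to ≼-refl; trans to ≼-trans)

  Contains : A → DecTotalOrder.Carrier O → Set
  Contains v e = left v ≼ e × e ≼ right v

  -- This plays the part of the clique number of an interval graph, with classes counted in place of
  -- intervals.
  ClassBound : ℕ → Set
  ClassBound r = ∀ e t (f : Fin t → A) → (∀ i j → line (f i) ≡ line (f j)) →
    (∀ i → Contains (f i) e) → (∀ {i j} → class (f i) ≡ class (f j) → i ≡ j) → t ≤ r

  -- The equivalence concerns overlapping intervals only: further along the line a colour may pass
  -- to another class, and a class may change its colour after a gap.
  Classifies : ∀ {r} → A → A → Fin r → Fin r → Set
  Classifies u w x y = line u ≡ line w → left u ≼ right w → left w ≼ right u →
    (class u ≡ class w → x ≡ y) × (x ≡ y → class u ≡ class w)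

  abstract
    -- Sweeping by left end-point, an interval takes over the colour of its class if that class is
    -- present at its left end-point, and otherwise a colour absent there.
    class-colouring : ∀ {r} → ClassBound r → ∀ xs → ∃ (Colouring.ColouringOf _≟_ (Classifies {r}) xs)
    class-colouring {r} bound xs =
      greedy Classifies
        (λ φ l wu uw → let φ₁ , φ₂ = φ (sym l) uw wu in sym ∘ φ₁ ∘ sym , sym ∘ φ₂ ∘ sym)
        (λ _ _ _ → (λ _ → refl) , (λ _ → refl))
        (λ _ → ⊤) (λ x xs _ → step x xs) default xs tt
      where
      open Colouring _≟_ {Fin r}
      -- A single interval is one class over its own left end-point, so 1 ≤ r.
      default : A → Fin r
      default v = inject≤ fzero (bound (left v) 1 (λ _ → v) (λ _ _ → refl)
        (λ _ → ≼-refl , left≤right v) (λ { {fzero} {fzero} _ → refl }))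
      step : ∀ x xs → Extendable Classifies (λ _ → ⊤) (x ∷ xs)
      step x xs = let ys , perm = ∈⇒↭ v∈ in
        v , ys , perm , tt , λ c good → extend (∈-resp-↭ (↭-sym perm) ∘ there) c good
        where
        -- Coloured last is an interval with the largest left end-point, so every other interval of
        -- its line that meets it contains that end-point.
        v : A
        v = argmax totalOrder left x xs
        v∈ : v ∈ x ∷ xs
        v∈ = [ here , there ]′ (argmax-sel totalOrder left x xs)
        left≤left : ∀ {w} → w ∈ x ∷ xs → left w ≼ left v
        left≤left (here refl) = f[⊥]≤f[argmax] totalOrder {f = left} x xs
        left≤left (there w∈)  = All.lookup (f[xs]≤f[argmax] totalOrder {f = left} x xs) w∈
        extend : ∀ {ys} → (∀ {w} → w ∈ ys → w ∈ x ∷ xs) → ∀ c → ColouringOf Classifies ys c →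
                 ∃[ γ ] (∀ {w} → w ∈ ys → Classifies v w γ (c w))
        extend {ys} ys⊆ c good with
          any? (λ w → (line w ≟S line v) ×-dec (left v ≼? right w) ×-dec (class w ≟K class v)) ys
        ... | yes same =
          let u , u∈ , lu , vu , κu = find same in
          c u , λ {w} w∈ l vw _ →
            -- `u` and `w` both contain `left v`, hence overlap, so `good` relates their colours to
            -- their classes.
            let φ₁ , φ₂ = good u∈ w∈ (trans lu l) (≼-trans (left≤left (ys⊆ u∈)) vw)
                            (≼-trans (left≤left (ys⊆ w∈)) vu) in
            φ₁ ∘ trans κu , trans (sym κu) ∘ φ₂
        ... | no ¬same with
          Fin.all? (λ γ →
            any? (λ w → (line w ≟S line v) ×-dec (left v ≼? right w) ×-dec (c w Fin.≟ γ)) ys)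
        ... | no ¬all =
          let γ , absent = Fin.¬∀⟶∃¬ r _ present? ¬all in
          γ , λ w∈ l vw _ →
            (λ κ → contradiction (lose w∈ (sym l , vw , sym κ)) ¬same) ,
            (λ γ≡cw → contradiction (lose w∈ (sym l , vw , sym γ≡cw)) absent)
          where
          present? : Decidable₁ λ γ → Any (λ w → line w ≡ line v × left v ≼ right w × c w ≡ γ) ys
          present? γ = any? (λ w → (line w ≟S line v) ×-dec (left v ≼? right w) ×-dec (c w Fin.≟ γ)) ys
        -- If all r colours occur over `left v`, one interval of each colour together with `v`
        -- yields r + 1 classes there.
        ... | yes all = contradiction (bound (left v) (suc r) f line-f contains-f distinct) ℕ.1+n≰n
          where
          f : Fin (suc r) → A
          f fzero    = v
          f (fsuc γ) = proj₁ (find (all γ))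
          f∈ : ∀ γ → f (fsuc γ) ∈ ys
          f∈ γ = proj₁ (proj₂ (find (all γ)))
          f-spec : ∀ γ → line (f (fsuc γ)) ≡ line v × left v ≼ right (f (fsuc γ)) × c (f (fsuc γ)) ≡ γ
          f-spec γ = proj₂ (proj₂ (find (all γ)))
          line-v : ∀ i → line (f i) ≡ line v
          line-v fzero    = refl
          line-v (fsuc γ) = proj₁ (f-spec γ)
          line-f : ∀ i j → line (f i) ≡ line (f j)
          line-f i j = trans (line-v i) (sym (line-v j))
          contains-f : ∀ i → Contains (f i) (left v)
          contains-f fzero    = ≼-refl , left≤right v
          contains-f (fsuc γ) = left≤left (ys⊆ (f∈ γ)) , proj₁ (proj₂ (f-spec γ))
          new : ∀ γ → class (f (fsuc γ)) ≢ class v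
          new γ eq = ¬same (lose (f∈ γ) (proj₁ (f-spec γ) , proj₁ (proj₂ (f-spec γ)) , eq))
          distinct : ∀ {i j} → class (f i) ≡ class (f j) → i ≡ j
          distinct {fzero}  {fzero}  _  = refl
          distinct {fzero}  {fsuc δ} eq = contradiction (sym eq) (new δ)
          distinct {fsuc γ} {fzero}  eq = contradiction eq (new γ)
          distinct {fsuc γ} {fsuc δ} eq = cong fsuc (trans (sym (colour γ))
            (trans (proj₁ (good (f∈ γ) (f∈ δ) (line-f (fsuc γ) (fsuc δ)) (meet γ δ) (meet δ γ)) eq)
                   (colour δ)))
            where
            colour : ∀ γ → c (f (fsuc γ)) ≡ γ
            colour γ = proj₂ (proj₂ (f-spec γ))
            meet : ∀ γ δ → left (f (fsuc γ)) ≼ right (f (fsuc δ))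
            meet γ δ = ≼-trans (proj₁ (contains-f (fsuc γ))) (proj₂ (contains-f (fsuc δ)))

-- A union bound, and maxima of a function on each fibre of a key.

length-filter-⊎ : {A : Set} {P Q : A → Set} (P? : Decidable₁ P) (Q? : Decidable₁ Q) → ∀ xs →
  length (filter (λ x → P? x ⊎-dec Q? x) xs) ≤ length (filter P? xs) + length (filter Q? xs)
length-filter-⊎ P? Q? [] = z≤n
length-filter-⊎ P? Q? (x ∷ xs) with ih ← length-filter-⊎ P? Q? xs | does (P? x) | does (Q? x)
... | true  | true  = s≤s (ℕ.≤-trans ih (ℕ.+-monoʳ-≤ (length (filter P? xs)) (ℕ.n≤1+n _)))
... | true  | false = s≤s ih
... | false | true  = ℕ.≤-trans (s≤s ih) (ℕ.≤-reflexive (sym (ℕ.+-suc _ _)))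
... | false | false = ih

module _ {D : Set} (_≟_ : DecidableEquality D) {n : ℕ}
         (key : Fin (suc n) → D) (value : Fin (suc n) → ℕ) where

  -- The successor sets a right key with value 0 apart from a wrong key, so one `argmax` finds a
  -- largest value among the entries with key `d`.
  weight : D → Fin (suc n) → ℕ
  weight d i = if does (key i ≟ d) then suc (value i) else 0

  weight-≡ : ∀ {d} i → key i ≡ d → weight d i ≡ suc (value i)
  weight-≡ {d} i eq rewrite dec-true (key i ≟ d) eq = refl

  weight-> : ∀ {d} i {k} → k < weight d i → key i ≡ d × k ≤ value i
  weight-> {d} i k< with key i ≟ d | k<
  ... | yes eq | s≤s k≤ = eq , k≤
  ... | no  _  | ()

  abstract
    argmaxima : Σ (D → Fin (suc n)) λ top →
                ∀ {d} i → key i ≡ d → key (top d) ≡ d × value i ≤ value (top d)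
    argmaxima = (λ d → argmax ℕ.≤-totalOrder (weight d) fzero (allFin (suc n))) , λ {d} i eq →
      weight-> (argmax ℕ.≤-totalOrder (weight d) fzero (allFin (suc n))) (subst (_≤ _) (weight-≡ i eq)
        (All.lookup (f[xs]≤f[argmax] ℕ.≤-totalOrder {f = weight d} fzero (allFin (suc n))) (∈-allFin i)))

-- Boxes with at most two local dimensions over a linear order.

module Boxes
  (O : DecTotalOrder 0ℓ 0ℓ 0ℓ)
  {m : ℕ} {D : Set} (_≟D_ : DecidableEquality D)
  (L U : Fin m → D → DecTotalOrder.Carrier O)
  (L≤U : ∀ v k → DecTotalOrder._≤_ O (L v k) (U v k))
  where

  open DecTotalOrder O using () renaming
    (Carrier to E; _≤_ to _≼_; _≤?_ to _≼?_; refl to ≼-refl; trans to ≼-trans; total to ≼-total)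

  V : Set
  V = Fin m

  -- For nonempty intervals these two inequalities express intersection, without reference to a
  -- common point.
  Meet : V → V → D → Set
  Meet u v k = L u k ≼ U v k × L v k ≼ U u k

  Intersect : V → V → Set
  Intersect u v = ∀ k → Meet u v k

  Intersect-refl : ∀ {v} → Intersect v v
  Intersect-refl k = L≤U _ k , L≤U _ k

  Intersect-sym : ∀ {u v} → Intersect u v → Intersect v u
  Intersect-sym uv k = let l , u = uv k in u , l

  CliqueBound : ℕ → Set
  CliqueBound r = ∀ {k} (f : Fin k → V) → Injective _≡_ _≡_ f → (∀ i j → Intersect (f i) (f j)) → k ≤ r

  -- Unboundedness outside `p v` and `q v` is recorded through its consequence, that every box is
  -- met there. The two dimensions may coincide.
  LocalIn : (p q : V → D) → Set
  LocalIn p q = ∀ {v k} → k ≢ p v → k ≢ q v → ∀ u → Meet u v k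

  module _ {r : ℕ} (clique≤r : CliqueBound r) where

    clique-list : ∀ {xs} → Unique xs → (∀ {u v} → u ∈ xs → v ∈ xs → Intersect u v) → length xs ≤ r
    clique-list {xs} uniq clique =
      clique≤r (lookup xs) (lookup-injective uniq) λ i j → clique (∈-lookup i) (∈-lookup j)

    module _ {p q : V → D} (local : LocalIn p q) where

      HitBy : V → List D → Set
      HitBy v ds = p v ∈ ds ⊎ q v ∈ ds

      dims : List V → List D
      dims []       = []
      dims (v ∷ vs) = p v ∷ q v ∷ dims vs

      HitBy-∷ : ∀ {v d ds} → HitBy v ds → HitBy v (d ∷ ds)
      HitBy-∷ = Sum.map there there

      missed⇒Meet : ∀ {v k ds} → ¬ HitBy v ds → k ∈ ds → ∀ w → Meet v w k
      missed⇒Meet miss k∈ w =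
        let l , u = local (λ { refl → miss (inj₁ k∈) }) (λ { refl → miss (inj₂ k∈) }) w in u , l

      -- In each dimension one of the two boxes is unrestricted: `v` in those of `ds`, and `w` in
      -- all others, as `ds` contains both of its local dimensions.
      missed⇒Intersect : ∀ {v w ds} → ¬ HitBy v ds → p w ∈ ds → q w ∈ ds → Intersect v w
      missed⇒Intersect {v} {w} {ds} miss pw∈ qw∈ k with k ≟D p w | k ≟D q w
      ... | no k≢pw  | no k≢qw  = local k≢pw k≢qw v
      ... | yes k≡pw | _        = missed⇒Meet miss (subst (_∈ ds) (sym k≡pw) pw∈) w
      ... | no _     | yes k≡qw = missed⇒Meet miss (subst (_∈ ds) (sym k≡qw) qw∈) w

      ∈-dims : ∀ {w ws} → w ∈ ws → p w ∈ dims ws × q w ∈ dims ws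
      ∈-dims (here refl) = here refl , there (here refl)
      ∈-dims (there w∈)  = let p∈ , q∈ = ∈-dims w∈ in there (there p∈) , there (there q∈)

      length-dims : ∀ ws → length (dims ws) ≡ length ws + length ws
      length-dims []       = refl
      length-dims (w ∷ ws) = cong suc (trans (cong suc (length-dims ws)) (sym (ℕ.+-suc _ _)))

      -- Greedy choice: a vertex that is not hit by the dimensions collected so far meets all chosen
      -- vertices by `missed⇒Intersect`, and so it joins the clique.
      maximal-disjoint : ∀ vs → ∃[ ws ] Unique ws × (∀ {u v} → u ∈ ws → v ∈ ws → Intersect u v) ×
                         (∀ {v} → v ∈ vs → HitBy v (dims ws))
      maximal-disjoint []       = [] , [] , (λ ()) , λ ()
      maximal-disjoint (v ∷ vs) with maximal-disjoint vs
      ... | ws , uniq , clique , hit with any? (p v ≟D_) (dims ws) ⊎-dec any? (q v ≟D_) (dims ws)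
      ... | yes hit-v = ws , uniq , clique , λ { (here refl) → hit-v ; (there u∈) → hit u∈ }
      ... | no  miss  = v ∷ ws , (¬Any⇒All¬ ws v∉ ∷ uniq) , clique′ ,
            λ { (here refl) → inj₁ (here refl) ; (there u∈) → HitBy-∷ (HitBy-∷ (hit u∈)) }
        where
        v∉ : v ∉ ws
        v∉ v∈ = miss (inj₁ (proj₁ (∈-dims v∈)))
        v-meets : ∀ {w} → w ∈ ws → Intersect v w
        v-meets w∈ = let p∈ , q∈ = ∈-dims w∈ in missed⇒Intersect miss p∈ q∈
        clique′ : ∀ {u w} → u ∈ v ∷ ws → w ∈ v ∷ ws → Intersect u w
        clique′ (here refl) (here refl) = Intersect-refl
        clique′ (here refl) (there w∈)  = v-meets w∈
        clique′ (there u∈)  (here refl) = Intersect-sym (v-meets u∈)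
        clique′ (there u∈)  (there w∈)  = clique u∈ w∈

      cover : ∃[ ds ] length ds ≤ r + r × (∀ v → HitBy v ds)
      cover with ws , uniq , clique , hit ← maximal-disjoint (allFin m) =
        dims ws ,
        ℕ.≤-trans (ℕ.≤-reflexive (length-dims ws))
                  (ℕ.+-mono-≤ (clique-list uniq clique) (clique-list uniq clique)) ,
        λ v → hit (∈-allFin v)

    -- Colouring all stars at once: crossing order, classes and corners.

    module Star {t : ℕ} (star : V → Fin t) {p q : V → D} (local : LocalIn p q)
                (star⇒p : ∀ {u v} → star u ≡ star v → p u ≡ p v) where

      left right bottom top : V → E
      left   v = L v (p v)
      right  v = U v (p v)
      bottom v = L v (q v)
      top    v = U v (q v)

      MeetX MeetY : V → V → Set
      MeetX u v = left u ≼ right v × left v ≼ right u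
      MeetY u v = bottom u ≼ top v × bottom v ≼ top u

      Meet-cong : ∀ {u v k l} → k ≡ l → Meet u v k → L u k ≼ U v l × L v l ≼ U u k
      Meet-cong refl uv = uv

      Meet-uncong : ∀ {u v k k₁ k₂} → k ≡ k₁ → k ≡ k₂ → L u k₁ ≼ U v k₂ × L v k₂ ≼ U u k₁ → Meet u v k
      Meet-uncong refl refl uv = uv

      Intersect⇒MeetX : ∀ {u v} → star u ≡ star v → Intersect u v → MeetX u v
      Intersect⇒MeetX s uv = Meet-cong (star⇒p s) (uv _)

      Intersect⇒MeetY : ∀ {u v} → q u ≡ q v → Intersect u v → MeetY u v
      Intersect⇒MeetY eq uv = Meet-cong eq (uv _)

      -- In any dimension other than the shared `p` and a common `q`, at least one of the two boxes
      -- is unrestricted.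
      Meet⇒Intersect : ∀ {u v} → star u ≡ star v → MeetX u v → (q u ≡ q v → MeetY u v) → Intersect u v
      Meet⇒Intersect {u} {v} s x y k with k ≟D p u | k ≟D q u | k ≟D q v
      ... | yes k≡p | _       | _       = Meet-uncong k≡p (trans k≡p (star⇒p s)) x
      ... | no k≢p  | no k≢q  | _       = let l , r = local k≢p k≢q v in r , l
      ... | no k≢p  | yes _   | no k≢q  = local (λ k≡p → k≢p (trans k≡p (sym (star⇒p s)))) k≢q u
      ... | no _    | yes k≡q | yes k≡q′ = Meet-uncong k≡q k≡q′ (y (trans (sym k≡q) k≡q′))

      -- Only the right ends are compared strictly. This makes the relation irreflexive, and it is
      -- what the last case of `corner` supplies.
      _≺_ : V → V → Set
      u ≺ v = star u ≡ star v × q u ≡ q v ×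
              left v ≼ left u × ¬ right v ≼ right u × bottom u ≼ bottom v × top v ≼ top u

      _≺?_ : Decidable _≺_
      u ≺? v = (star u Fin.≟ star v) ×-dec (q u ≟D q v) ×-dec (left v ≼? left u) ×-dec
               ¬? (right v ≼? right u) ×-dec (bottom u ≼? bottom v) ×-dec (top v ≼? top u)

      ⋠⇒≽ : ∀ {x y} → ¬ x ≼ y → y ≼ x
      ⋠⇒≽ {x} {y} x⋠y = [ (λ x≼y → contradiction x≼y x⋠y) , (λ y≼x → y≼x) ]′ (≼-total x y)

      ≺-trans : ∀ {u v w} → u ≺ v → v ≺ w → u ≺ w
      ≺-trans (s , e , l , r , b , t) (s′ , e′ , l′ , r′ , b′ , t′) =
        trans s s′ , trans e e′ , ≼-trans l′ l , (λ w≼u → r′ (≼-trans w≼u (⋠⇒≽ r))) ,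
        ≼-trans b b′ , ≼-trans t′ t

      ≺⇒≢ : ∀ {u v} → u ≺ v → u ≢ v
      ≺⇒≢ (_ , _ , _ , r , _) refl = r ≼-refl

      ≺⇒Intersect : ∀ {u v} → u ≺ v → Intersect u v
      ≺⇒Intersect {u} {v} (s , _ , l , r , b , t) = Meet⇒Intersect s
        (≼-trans (L≤U u _) (⋠⇒≽ r) , ≼-trans l (L≤U u _))
        (λ _ → ≼-trans b (L≤U v _) , ≼-trans (L≤U v _) t)

      -- The number counts steps, so such a chain has one more member than it says, `v` included.
      Chain : V → ℕ → Set
      Chain v zero    = ⊤
      Chain v (suc k) = ∃[ w ] v ≺ w × Chain w k

      Chain? : ∀ v k → Dec (Chain v k)
      Chain? v zero    = yes tt
      Chain? v (suc k) = Fin.any? λ w → (v ≺? w) ×-dec Chain? w k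

      -- Positions past the end return the last member, which makes `at` total.
      at : ∀ {v} k → Chain v k → ℕ → V
      at {v} zero    _            _       = v
      at {v} (suc k) _            zero    = v
      at     (suc k) (_ , _ , ch) (suc i) = at k ch i

      at-zero : ∀ {v} k (ch : Chain v k) → at k ch 0 ≡ v
      at-zero zero    _ = refl
      at-zero (suc k) _ = refl

      at-suc : ∀ {v} k (ch : Chain v k) {i} → i < k → v ≺ at k ch (suc i)
      at-suc (suc k) (w , v≺w , ch) {zero}  _         = subst (_ ≺_) (sym (at-zero k ch)) v≺w
      at-suc (suc k) (w , v≺w , ch) {suc i} (s≤s i<k) = ≺-trans v≺w (at-suc k ch i<k)

      at-origin : ∀ {v} k (ch : Chain v k) {i} → i ≤ k → v ≡ at k ch i ⊎ v ≺ at k ch i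
      at-origin k ch {zero}  _   = inj₁ (sym (at-zero k ch))
      at-origin k ch {suc i} i<k = inj₂ (at-suc k ch i<k)

      at-< : ∀ {v} k (ch : Chain v k) {i j} → i < j → j ≤ k → at k ch i ≺ at k ch j
      at-< (suc k) ch           {zero}  {suc j} _         j≤k       = at-suc (suc k) ch j≤k
      at-< (suc k) (_ , _ , ch) {suc i} {suc j} (s≤s i<j) (s≤s j≤k) = at-< k ch i<j j≤k

      -- The k + 1 members of the chain are distinct and pairwise intersecting. The bound limits the
      -- search in `longest`.
      Chain⇒≤ : ∀ {v} k → Chain v k → k ≤ r
      Chain⇒≤ {v} k ch = ℕ.≤-trans (ℕ.n≤1+n k) (clique≤r f f-injective f-clique)
        where
        f : Fin (suc k) → V
        f = at k ch ∘ toℕ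
        below : ∀ (i : Fin (suc k)) → toℕ i ≤ k
        below = ℕ.≤-pred ∘ Fin.toℕ<n
        f-injective : Injective _≡_ _≡_ f
        f-injective {i} {j} eq with ℕ.<-cmp (toℕ i) (toℕ j)
        ... | tri< i<j _ _ = contradiction eq (≺⇒≢ (at-< k ch i<j (below j)))
        ... | tri≈ _ i≡j _ = Fin.toℕ-injective i≡j
        ... | tri> _ _ j<i = contradiction (sym eq) (≺⇒≢ (at-< k ch j<i (below i)))
        f-clique : ∀ i j → Intersect (f i) (f j)
        f-clique i j with ℕ.<-cmp (toℕ i) (toℕ j)
        ... | tri< i<j _ _ = ≺⇒Intersect (at-< k ch i<j (below j))
        ... | tri≈ _ i≡j _ = subst (Intersect (f i) ∘ at k ch) i≡j Intersect-refl
        ... | tri> _ _ j<i = Intersect-sym (≺⇒Intersect (at-< k ch j<i (below i)))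

      abstract
        longest : ∀ v → ∃[ h ] Chain v h × (∀ k → Chain v k → k ≤ h)
        longest v = greatest (Chain? v) tt r Chain⇒≤

      height : V → ℕ
      height v = proj₁ (longest v)

      chain : ∀ v → Chain v (height v)
      chain v = proj₁ (proj₂ (longest v))

      ≺⇒height< : ∀ {u v} → u ≺ v → height v < height u
      ≺⇒height< {u} {v} u≺v = proj₂ (proj₂ (longest u)) (suc (height v)) (v , u≺v , chain v)

      Class : Set
      Class = Fin t × D × ℕ

      _≟C_ : DecidableEquality Class
      _≟C_ = ≡-dec Fin._≟_ (≡-dec _≟D_ ℕ._≟_)

      class : V → Class
      class v = star v , q v , height v

      class⇒star : ∀ {u v} → class u ≡ class v → star u ≡ star v
      class⇒star = cong proj₁

      class⇒q : ∀ {u v} → class u ≡ class v → q u ≡ q v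
      class⇒q = cong (proj₁ ∘ proj₂)

      open Sweep O Fin._≟_ Fin._≟_ _≟C_ star class class⇒star left right (λ v → L≤U v (p v))

      -- The class of f i is represented by the element of height (f i) steps up the chain of the
      -- highest box over e that has the same q.
      class-bound : ClassBound r
      class-bound e zero    f _    _   _        = z≤n
      class-bound e (suc n) f line con distinct = clique≤r g g-injective g-clique
        where
        highest : D → Fin (suc n)
        highest = proj₁ (argmaxima _≟D_ (q ∘ f) (height ∘ f))

        highest-spec : ∀ {d} i → q (f i) ≡ d →
                       q (f (highest d)) ≡ d × height (f i) ≤ height (f (highest d))
        highest-spec = proj₂ (argmaxima _≟D_ (q ∘ f) (height ∘ f))

        above : D → V
        above d = f (highest d)

        g : Fin (suc n) → V
        g i = at (height (above (q (f i)))) (chain (above (q (f i)))) (height (f i))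

        g-origin : ∀ i → above (q (f i)) ≡ g i ⊎ above (q (f i)) ≺ g i
        g-origin i =
          at-origin (height (above (q (f i)))) (chain (above (q (f i)))) (proj₂ (highest-spec i refl))

        star-g : ∀ i → star (g i) ≡ star (f i)
        star-g i = trans (sym ([ cong star , proj₁ ]′ (g-origin i))) (line (highest (q (f i))) i)

        q-g : ∀ i → q (g i) ≡ q (f i)
        q-g i = trans (sym ([ cong q , proj₁ ∘ proj₂ ]′ (g-origin i))) (proj₁ (highest-spec i refl))

        -- A step up the chain widens the interval along `p`, so `e` stays inside.
        Contains-≺ : ∀ {u v} → Contains u e → u ≺ v → Contains v e
        Contains-≺ (lu≼e , e≼ru) (_ , _ , l , r , _ , _) = ≼-trans l lu≼e , ≼-trans e≼ru (⋠⇒≽ r)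

        contains-g : ∀ i → Contains (g i) e
        contains-g i =
          [ (λ eq → subst (λ v → Contains v e) eq here-e) , Contains-≺ here-e ]′ (g-origin i)
          where
          here-e : Contains (above (q (f i))) e
          here-e = con (highest (q (f i)))

        g-< : ∀ i j → q (f i) ≡ q (f j) → height (f i) < height (f j) → g i ≺ g j
        g-< i j eq h< = subst (λ d → at (height (above d)) (chain (above d)) (height (f i)) ≺ g j) (sym eq)
          (at-< (height (above (q (f j)))) (chain (above (q (f j)))) h< (proj₂ (highest-spec j refl)))

        Compared : Fin (suc n) → Fin (suc n) → Set
        Compared i j = i ≡ j ⊎ g i ≺ g j ⊎ g j ≺ g i ⊎ q (g i) ≢ q (g j)

        -- For equal `q` both representatives lie on the same chain, at positions given by the
        -- heights; equal heights mean equal classes, hence equal indices by `distinct`.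
        compare : ∀ i j → Compared i j
        compare i j with q (f i) ≟D q (f j) | ℕ.<-cmp (height (f i)) (height (f j))
        ... | no neq | _            = inj₂ (inj₂ (inj₂ λ eq → neq (trans (sym (q-g i)) (trans eq (q-g j)))))
        ... | yes eq | tri< h< _ _  = inj₂ (inj₁ (g-< i j eq h<))
        ... | yes eq | tri≈ _ h≡ _  = inj₁ (distinct (cong₂ _,_ (line i j) (cong₂ _,_ eq h≡)))
        ... | yes eq | tri> _ _ h>  = inj₂ (inj₂ (inj₁ (g-< j i (sym eq) h>)))

        g-injective : Injective _≡_ _≡_ g
        g-injective {i} {j} eq with compare i j
        ... | inj₁ i≡j                = i≡j
        ... | inj₂ (inj₁ gi≺gj)        = contradiction eq (≺⇒≢ gi≺gj)
        ... | inj₂ (inj₂ (inj₁ gj≺gi)) = contradiction (sym eq) (≺⇒≢ gj≺gi)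
        ... | inj₂ (inj₂ (inj₂ q≢))    = contradiction (cong q eq) q≢

        g-clique : ∀ i j → Intersect (g i) (g j)
        g-clique i j with compare i j
        ... | inj₁ refl               = Intersect-refl
        ... | inj₂ (inj₁ gi≺gj)        = ≺⇒Intersect gi≺gj
        ... | inj₂ (inj₂ (inj₁ gj≺gi)) = Intersect-sym (≺⇒Intersect gj≺gi)
        -- With different `q` only the dimension `p` restricts both boxes, and there both contain
        -- `e`.
        ... | inj₂ (inj₂ (inj₂ q≢))    = Meet⇒Intersect (trans (star-g i) (trans (line i j) (sym (star-g j))))
          (let l , r = contains-g i ; l′ , r′ = contains-g j in ≼-trans l r′ , ≼-trans l′ r)
          (λ eq → contradiction eq q≢)

      Holds : V → E → E → Set
      Holds v x y = left v ≼ x × x ≼ right v × bottom v ≼ y × y ≼ top v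

      Near : E → E → V → V → Set
      Near x y u v = class u ≡ class v × Holds v x y

      Near? : ∀ x y → Decidable (Near x y)
      Near? x y u v = (class u ≟C class v) ×-dec
        (left v ≼? x) ×-dec (x ≼? right v) ×-dec (bottom v ≼? y) ×-dec (y ≼? top v)

      -- Boxes of one class share `p` and `q`, so a common point in these two dimensions makes them
      -- a clique.
      near≤r : ∀ x y u → length (filter (Near? x y u) (allFin m)) ≤ r
      near≤r x y u = clique-list (filter⁺ (Near? x y u) (allFin⁺ m)) λ v∈ w∈ →
        let _ , κ  , l  , r  , b  , t  = ∈-filter⁻ (Near? x y u) {xs = allFin m} v∈
            _ , κ′ , l′ , r′ , b′ , t′ = ∈-filter⁻ (Near? x y u) {xs = allFin m} w∈
        in Meet⇒Intersect (trans (sym (class⇒star κ)) (class⇒star κ′))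
             (≼-trans l r′ , ≼-trans l′ r) (λ _ → ≼-trans b t′ , ≼-trans b′ t)

      Corner : V → V → Set
      Corner u v = Near (left u) (bottom u) u v ⊎ Near (left u) (top u) u v ⊎ Near (right u) (bottom u) u v

      Corner? : Decidable Corner
      Corner? u v = Near? _ _ u v ⊎-dec Near? _ _ u v ⊎-dec Near? _ _ u v

      corner≤3r : ∀ u → outdegree Corner? (allFin m) u ≤ r + (r + r)
      corner≤3r u = ℕ.≤-trans (length-filter-⊎ (Near? (left u) (bottom u) u) _ (allFin m))
        (ℕ.+-mono-≤ (near≤r (left u) (bottom u) u)
          (ℕ.≤-trans (length-filter-⊎ (Near? (left u) (top u) u) (Near? (right u) (bottom u) u) (allFin m))
            (ℕ.+-mono-≤ (near≤r (left u) (top u) u) (near≤r (right u) (bottom u) u))))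

      class⇒⊀ : ∀ {u v} → class u ≡ class v → ¬ u ≺ v
      class⇒⊀ κ u≺v = ℕ.<-irrefl (cong (proj₂ ∘ proj₂) (sym κ)) (≺⇒height< u≺v)

      -- If `v` starts or ends within the vertical range of `u`, its lower or upper left corner lies
      -- in `u`. Otherwise `v` spans `u` vertically: either the lower right corner of `u` lies in
      -- `v`, or `v ≺ u`, which equal heights exclude.
      corner : ∀ {u v} → class u ≡ class v → left u ≼ left v → MeetX u v → MeetY u v →
               Corner u v ⊎ Corner v u
      corner {u} {v} κ lu≼lv (_ , lv≼ru) (bu≼tv , bv≼tu) with ≼-total (bottom u) (bottom v)
      ... | inj₁ bu≼bv = inj₂ (inj₁ (sym κ , lu≼lv , lv≼ru , bu≼bv , bv≼tu))
      ... | inj₂ bv≼bu with top v ≼? top u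
      ...   | yes tv≼tu = inj₂ (inj₂ (inj₁ (sym κ , lu≼lv , lv≼ru , bu≼tv , tv≼tu)))
      ...   | no  tv⋠tu with right u ≼? right v
      ...     | yes ru≼rv = inj₁ (inj₂ (inj₂ (κ , lv≼ru , ru≼rv , bv≼bu , bu≼tv)))
      ...     | no  ru⋠rv = contradiction
        (sym (class⇒star κ) , sym (class⇒q κ) , lu≼lv , ru⋠rv , bv≼bu , ⋠⇒≽ tv⋠tu) (class⇒⊀ (sym κ))

      Intersect⇒Corner : ∀ {u v} → class u ≡ class v → Intersect u v → Corner u v ⊎ Corner v u
      Intersect⇒Corner {u} {v} κ uv with ≼-total (left u) (left v)
      ... | inj₁ lu≼lv = corner κ lu≼lv (Intersect⇒MeetX (class⇒star κ) uv) (Intersect⇒MeetY (class⇒q κ) uv)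
      ... | inj₂ lv≼lu = Sum.swap (corner (sym κ) lv≼lu
        (Intersect⇒MeetX (sym (class⇒star κ)) (Intersect-sym uv))
        (Intersect⇒MeetY (sym (class⇒q κ)) (Intersect-sym uv)))

      -- The factors stand for the star, the colour from the sweep and one of 6r + 1 colours from
      -- the corner relation.
      colours : ℕ
      colours = t * (r * suc (r + (r + r) + (r + (r + r))))

      star-colouring : Σ (V → Fin colours) λ c → ∀ {u v} → u ≢ v → Intersect u v → c u ≢ c v
      star-colouring = c , proper
        where
        by-class : ∃ (Colouring.ColouringOf Fin._≟_ (Classifies {r}) (allFin m))
        by-class = class-colouring class-bound (allFin m)
        by-corner : ∃ (Colouring.ColouringOf Fin._≟_ (Separates Fin._≟_ Corner? (r + (r + r))) (allFin m))
        by-corner = bounded-outdegree-colouring Fin._≟_ Corner? (r + (r + r)) (allFin m) corner≤3r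
        c₁ : V → Fin r
        c₁ = proj₁ by-class
        c₂ : V → Fin (suc (r + (r + r) + (r + (r + r))))
        c₂ = proj₁ by-corner
        c : V → Fin colours
        c v = combine (star v) (combine (c₁ v) (c₂ v))
        proper : ∀ {u v} → u ≢ v → Intersect u v → c u ≢ c v
        proper {u} {v} u≢v uv eq =
          let star≡ , eq′ = Fin.combine-injective (star u) (combine (c₁ u) (c₂ u))
                                                  (star v) (combine (c₁ v) (c₂ v)) eq
              c₁≡ , c₂≡ = Fin.combine-injective (c₁ u) (c₂ u) (c₁ v) (c₂ v) eq′
              lu≼rv , lv≼ru = Intersect⇒MeetX star≡ uv
              -- Equal sweep colours give equal classes because the two boxes overlap along `p`.
              κ = proj₂ (proj₂ by-class (∈-allFin u) (∈-allFin v) star≡ lu≼rv lv≼ru) c₁≡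
          in proj₂ by-corner (∈-allFin u) (∈-allFin v) u≢v (Intersect⇒Corner κ uv) c₂≡

    abstract
      box-colouring : ∀ {p q} → LocalIn p q →
        Σ ℕ λ K → K ≤ (r + r) * (r * suc (r + (r + r) + (r + (r + r)))) ×
        Σ (V → Fin K) λ c → ∀ {u v} → u ≢ v → Intersect u v → c u ≢ c v
      box-colouring {p} {q} local with ds , ds≤2r , hit ← cover local =
        _ , ℕ.*-monoˡ-≤ _ ds≤2r , Star.star-colouring star {p′} {q′} local′ star⇒p′
        where
        -- A vertex is assigned to the position in `ds` of one of its local dimensions; `p′` is that
        -- dimension and `q′` the other.
        star : V → Fin (length ds)
        star v = [ index , index ]′ (hit v)
        p′ q′ : V → D
        p′ v = [ (λ _ → p v) , (λ _ → q v) ]′ (hit v)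
        q′ v = [ (λ _ → q v) , (λ _ → p v) ]′ (hit v)
        local′ : LocalIn p′ q′
        local′ {v} k≢p k≢q with hit v
        ... | inj₁ _ = local k≢p k≢q
        ... | inj₂ _ = local k≢q k≢p
        p′≡ : ∀ v → p′ v ≡ lookup ds (star v)
        p′≡ v with hit v
        ... | inj₁ p∈ = lookup-index p∈
        ... | inj₂ q∈ = lookup-index q∈
        star⇒p′ : ∀ {u v} → star u ≡ star v → p′ u ≡ p′ v
        star⇒p′ {u} {v} eq = trans (p′≡ u) (trans (cong (lookup ds) eq) (sym (p′≡ v)))

-- Interval end-points as a linear order.

-- (1 , q , s) stands for a position just below, at or just above q, according as s is 0, 1 or 2;
-- the first component is 0 for −∞ and 2 for +∞.
endpointOrder : DecTotalOrder _ _ _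
endpointOrder = ×-decTotalOrder ℕ.≤-decTotalOrder (×-decTotalOrder ℚ.≤-decTotalOrder ℕ.≤-decTotalOrder)

open DecTotalOrder endpointOrder using () renaming
  (Carrier to Endpoint; _≤_ to _≼_; _≤?_ to _≼?_; trans to ≼-trans; total to ≼-total)

≼⁺ : ∀ {x y s t} → x ℚ.≤ y → (x ≡ y → s ≤ t) → (1 , x , s) ≼ (1 , y , t)
≼⁺ {x} {y} x≤y s≤t with x ℚ.≟ y
... | yes x≡y = inj₂ (refl , inj₂ (x≡y , s≤t x≡y))
... | no  x≢y = inj₂ (refl , inj₁ (x≤y , x≢y))

≼⁻ : ∀ {x y s t} → (1 , x , s) ≼ (1 , y , t) → x ℚ.≤ y × (x ≡ y → s ≤ t)
≼⁻ (inj₁ (_ , 1≢1))                = contradiction refl 1≢1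
≼⁻ (inj₂ (_ , inj₁ (x≤y , x≢y)))   = x≤y , λ x≡y → contradiction x≡y x≢y
≼⁻ (inj₂ (_ , inj₂ (refl , s≤t)))  = ℚ.≤-refl , λ _ → s≤t

<⇒≼ : ∀ {x y s t} → x ℚ.< y → (1 , x , s) ≼ (1 , y , t)
<⇒≼ x<y = ≼⁺ (ℚ.<⇒≤ x<y) λ { refl → contradiction x<y (ℚ.<-irrefl refl) }

point : ℚ → Endpoint
point x = 1 , x , 1

-- Open ends are shifted inwards infinitesimally, so that `lower A ≼ upper A` holds exactly when `A`
-- contains a rational point.
lower upper : Interval → Endpoint
lower (bounded l true  _ _) = 1 , l , 1
lower (bounded l false _ _) = 1 , l , 2
lower whole                 = 0 , 0ℚ , 0
upper (bounded _ _ u true)  = 1 , u , 1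
upper (bounded _ _ u false) = 1 , u , 0
upper whole                 = 2 , 0ℚ , 0

≤∧≢⇒< : ∀ {x y} → x ℚ.≤ y → x ≢ y → x ℚ.< y
≤∧≢⇒< {x} {y} x≤y x≢y with x ℚ.<? y
... | yes x<y = x<y
... | no  x≮y = contradiction (ℚ.≤-antisym x≤y (ℚ.≮⇒≥ x≮y)) x≢y

lower⁺ : ∀ {x} A → x ∈I A → lower A ≼ point x
lower⁺ (bounded l true  u _) (l≤x , _) = ≼⁺ l≤x λ _ → ℕ.≤-refl
lower⁺ (bounded l false u _) (l<x , _) = <⇒≼ l<x
lower⁺ whole                 _         = inj₁ (z≤n , λ ())

upper⁺ : ∀ {x} A → x ∈I A → point x ≼ upper A
upper⁺ (bounded l _ u true)  (_ , x≤u) = ≼⁺ x≤u λ _ → ℕ.≤-refl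
upper⁺ (bounded l _ u false) (_ , x<u) = <⇒≼ x<u
upper⁺ whole                 _         = inj₁ (s≤s z≤n , λ ())

between⇒∈ : ∀ {x} A → lower A ≼ point x → point x ≼ upper A → x ∈I A
between⇒∈ whole _ _ = tt
between⇒∈ {x} (bounded l lc u uc) l≼x x≼u = low lc l≼x , upp uc x≼u
  where
  low : ∀ lc → lower (bounded l lc u uc) ≼ point x → LowerOK l lc x
  low true  le = proj₁ (≼⁻ le)
  low false le = let l≤x , 2≤1 = ≼⁻ le in ≤∧≢⇒< l≤x λ l≡x → ℕ.1+n≰n (2≤1 l≡x)
  upp : ∀ uc → point x ≼ upper (bounded l lc u uc) → UpperOK u uc x
  upp true  le = proj₁ (≼⁻ le)
  upp false le = let x≤u , 1≤0 = ≼⁻ le in ≤∧≢⇒< x≤u λ x≡u → ℕ.1+n≰n (1≤0 x≡u)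

x-1<x : ∀ x → x ℚ.- 1ℚ ℚ.< x
x-1<x x = subst (x ℚ.- 1ℚ ℚ.<_) (ℚ.+-identityʳ x) (ℚ.+-monoʳ-< x (ℚ.negative⁻¹ (ℚ.- 1ℚ)))

x<x+1 : ∀ x → x ℚ.< x ℚ.+ 1ℚ
x<x+1 x = subst (ℚ._< x ℚ.+ 1ℚ) (ℚ.+-identityʳ x) (ℚ.+-monoʳ-< x (ℚ.positive⁻¹ 1ℚ))

-- A closed end among the two bounded ones is itself such a point, and between two open ends density
-- provides one. Beside an unbounded end a step of length 1 from the other end suffices.
point-between : ∀ A B → lower A ≼ upper B → ∃[ x ] lower A ≼ point x × point x ≼ upper B
point-between whole whole _ = 0ℚ , inj₁ (z≤n , λ ()) , inj₁ (s≤s z≤n , λ ())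
point-between whole (bounded _ _ u true)  _ = u ℚ.- 1ℚ , inj₁ (z≤n , λ ()) , <⇒≼ (x-1<x u)
point-between whole (bounded _ _ u false) _ = u ℚ.- 1ℚ , inj₁ (z≤n , λ ()) , <⇒≼ (x-1<x u)
point-between (bounded l true  _ _) whole _ = l ℚ.+ 1ℚ , <⇒≼ (x<x+1 l) , inj₁ (s≤s z≤n , λ ())
point-between (bounded l false _ _) whole _ = l ℚ.+ 1ℚ , <⇒≼ (x<x+1 l) , inj₁ (s≤s z≤n , λ ())
point-between (bounded l true  _ _) B@(bounded _ _ _ _)  l≼u = l , ≼⁺ ℚ.≤-refl (λ _ → ℕ.≤-refl) , l≼u
point-between (bounded l false _ _) (bounded _ _ u true)  l≼u = u , l≼u , ≼⁺ ℚ.≤-refl (λ _ → ℕ.≤-refl)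
point-between (bounded l false _ _) (bounded _ _ u false) l≼u =
  let l≤u , 2≤0 = ≼⁻ l≼u
      x , l<x , x<u = ℚ.<-dense (≤∧≢⇒< l≤u (λ l≡u → contradiction (2≤0 l≡u) λ ()))
  in x , <⇒≼ l<x , <⇒≼ x<u

-- The intersection runs from the larger lower end to the smaller upper end; for each order of the
-- ends one hypothesis compares exactly these two.
common-point : ∀ A B → lower A ≼ upper A → lower B ≼ upper B → lower A ≼ upper B → lower B ≼ upper A →
               ∃[ x ] x ∈I A × x ∈I B
common-point A B AA BB AB BA with ≼-total (lower A) (lower B) | ≼-total (upper A) (upper B)
... | inj₁ l | inj₁ u = let x , lx , xu = point-between B A BA in
  x , between⇒∈ A (≼-trans l lx) xu , between⇒∈ B lx (≼-trans xu u)
... | inj₁ l | inj₂ u = let x , lx , xu = point-between B B BB in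
  x , between⇒∈ A (≼-trans l lx) (≼-trans xu u) , between⇒∈ B lx xu
... | inj₂ l | inj₁ u = let x , lx , xu = point-between A A AA in
  x , between⇒∈ A lx xu , between⇒∈ B (≼-trans l lx) (≼-trans xu u)
... | inj₂ l | inj₂ u = let x , lx , xu = point-between A B AB in
  x , between⇒∈ A lx (≼-trans xu u) , between⇒∈ B (≼-trans l lx) xu

whole-meets : ∀ A → lower A ≼ upper whole × lower whole ≼ upper A
whole-meets A = lower≼ A , ≼upper A
  where
  lower≼ : ∀ A → lower A ≼ upper whole
  lower≼ (bounded _ true  _ _) = inj₁ (s≤s z≤n , λ ())
  lower≼ (bounded _ false _ _) = inj₁ (s≤s z≤n , λ ())
  lower≼ whole                 = inj₁ (z≤n , λ ())
  ≼upper : ∀ A → lower whole ≼ upper A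
  ≼upper (bounded _ _ _ true)  = inj₁ (z≤n , λ ())
  ≼upper (bounded _ _ _ false) = inj₁ (z≤n , λ ())
  ≼upper whole                 = inj₁ (z≤n , λ ())

isBounded-false : ∀ {A} → isBounded A ≡ false → A ≡ whole
isBounded-false {whole} _ = refl

-- Extracting two local dimensions.

trues : ∀ {d} (f : Fin d → Bool) →
        ∃[ is ] length is ≤ countTrue f × (∀ {i} → i ∉ is → f i ≡ false)
trues {zero}  f = [] , z≤n , λ { {()} }
trues {suc d} f with f fzero in eq | trues (f ∘ fsuc)
... | true  | is , few , rest =
  fzero ∷ map fsuc is , s≤s (ℕ.≤-trans (ℕ.≤-reflexive (length-map fsuc is)) few) ,
  λ { {fzero}  0∉ → contradiction (here refl) 0∉
    ; {fsuc i} i∉ → rest (i∉ ∘ there ∘ ∈-map⁺ fsuc) }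
... | false | is , few , rest =
  map fsuc is , ℕ.≤-trans (ℕ.≤-reflexive (length-map fsuc is)) few ,
  λ { {fzero} _ → eq ; {fsuc i} i∉ → rest (i∉ ∘ ∈-map⁺ fsuc) }

-- Missing dimensions are filled by repetition or by `fzero`, whence the domain `Fin (suc d)`.
two-trues : ∀ {d} (f : Fin (suc d) → Bool) → countTrue f ≤ 2 →
            ∃₂ λ p q → ∀ {i} → i ≢ p → i ≢ q → f i ≡ false
two-trues f ≤2 with trues f
... | []         , _ , rest = fzero , fzero , λ _ _ → rest λ ()
... | p ∷ []     , _ , rest = p , p , λ i≢p _ → rest λ { (here eq) → i≢p eq }
... | p ∷ q ∷ [] , _ , rest =
  p , q , λ i≢p i≢q → rest λ { (here eq) → i≢p eq ; (there (here eq)) → i≢q eq }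
... | _ ∷ _ ∷ _ ∷ _ , few , _ = contradiction (ℕ.≤-trans few ≤2) λ { (s≤s (s≤s ())) }

-- The number of colours.

palette : ℕ → ℕ
palette r = (r + r) * (r * suc (r + (r + r) + (r + (r + r))))

-- For r ≥ 1 the factor 6r + 1 is at most 7r, which gives 2r · r · 7r = 14 r³.
palette≤ : ∀ r → palette r ≤ 320 * (r * r * r)
palette≤ zero      = z≤n
palette≤ r@(suc _) = begin
  (r + r) * (r * suc (r + (r + r) + (r + (r + r))))
    ≤⟨ ℕ.*-monoʳ-≤ (r + r) (ℕ.*-monoʳ-≤ r (ℕ.+-monoˡ-≤ _ (s≤s z≤n))) ⟩
  (r + r) * (r * (r + (r + (r + r) + (r + (r + r)))))
    ≡⟨ solve 1 (λ r → (r :+ r) :* (r :* (r :+ (r :+ (r :+ r) :+ (r :+ (r :+ r)))))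
                      := con 14 :* (r :* r :* r)) refl r ⟩
  14 * (r * r * r)
    ≤⟨ ℕ.*-monoˡ-≤ (r * r * r) (ℕ.m≤m+n 14 306) ⟩
  320 * (r * r * r) ∎
  where
  open ℕ.≤-Reasoning
  open +-*-Solver

-- This is the bound in exponential form. For r ≥ 1 the base 2r is at least 2, that is, log(2r) ≥ 1;
-- for r = 0 both sides are 1.
2^palette≤ : ∀ r → 2 ^ palette r ≤ (2 * r) ^ (320 * (r * r * r))
2^palette≤ zero      = ℕ.≤-refl
2^palette≤ r@(suc _) = ℕ.≤-trans (ℕ.^-monoʳ-≤ 2 (palette≤ r))
  (ℕ.^-monoˡ-≤ (320 * (r * r * r)) (ℕ.m≤m*n 2 r))

-- From a graph with local boxes to its colouring.

module Colour (G : Graph) {r d : ℕ} (ω≤r : ∀ k (f : Fin k → Fin (n G)) → IsClique G k f → k ≤ r)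
              (B : Fin (n G) → Box (suc d)) (2-local : ∀ v → numLocal (B v) ≤ 2)
              (adj⇔ : ∀ u v → ¬ u ≡ v → Adj G u v ⇔ BoxesIntersect (B u) (B v)) where

  -- An interval with lo > hi is empty, and then the vertex is isolated.
  Nonempty : Fin (n G) → Set
  Nonempty v = ∀ k → lower (B v k) ≼ upper (B v k)

  Nonempty? : Decidable₁ Nonempty
  Nonempty? v = Fin.all? λ k → lower (B v k) ≼? upper (B v k)

  vertices : List (Fin (n G))
  vertices = filter Nonempty? (allFin (n G))

  vertex : Fin (length vertices) → Fin (n G)
  vertex = lookup vertices

  vertex-injective : Injective _≡_ _≡_ vertex
  vertex-injective = lookup-injective (filter⁺ Nonempty? (allFin⁺ (n G)))

  nonempty : ∀ i → Nonempty (vertex i)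
  nonempty i = proj₂ (∈-filter⁻ Nonempty? {xs = allFin (n G)} (∈-lookup i))

  open Boxes endpointOrder Fin._≟_ (λ i k → lower (B (vertex i) k)) (λ i k → upper (B (vertex i) k)) nonempty
    using (Intersect; CliqueBound; LocalIn; box-colouring)

  Intersect⇒Adj : ∀ {i j} → i ≢ j → Intersect i j → Adj G (vertex i) (vertex j)
  Intersect⇒Adj {i} {j} i≢j ij = Equivalence.from (adj⇔ _ _ (i≢j ∘ vertex-injective))
    ((λ k → proj₁ (common k)) , λ k → proj₂ (common k))
    where
    common : ∀ k → ∃[ x ] x ∈I B (vertex i) k × x ∈I B (vertex j) k
    common k = common-point _ _ (nonempty i k) (nonempty j k) (proj₁ (ij k)) (proj₂ (ij k))

  Adj⇒lower≼upper : ∀ {u v} → Adj G u v → ∀ k → lower (B u k) ≼ upper (B v k)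
  Adj⇒lower≼upper {u} {v} uv k
    with x , x∈ ← Equivalence.to (adj⇔ u v λ { refl → irrefl G uv }) uv =
    ≼-trans (lower⁺ (B u k) (proj₁ (x∈ k))) (upper⁺ (B v k) (proj₂ (x∈ k)))

  Adj⇒Nonempty : ∀ {u v} → Adj G u v → Nonempty u
  Adj⇒Nonempty {u} {v} uv k
    with x , x∈ ← Equivalence.to (adj⇔ u v λ { refl → irrefl G uv }) uv =
    ≼-trans (lower⁺ (B u k) (proj₁ (x∈ k))) (upper⁺ (B u k) (proj₁ (x∈ k)))

  clique≤r : CliqueBound r
  clique≤r {k} f f-inj f-clique = ω≤r k (vertex ∘ f)
    ((λ eq → f-inj (vertex-injective eq)) , λ i j i≢j → Intersect⇒Adj (i≢j ∘ f-inj) (f-clique i j))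

  local-dimensions : ∀ v → ∃₂ λ p q → ∀ {k} → k ≢ p → k ≢ q → isBounded (B v k) ≡ false
  local-dimensions v = two-trues (λ k → isBounded (B v k)) (2-local v)

  p q : Fin (length vertices) → Fin (suc d)
  p i = proj₁ (local-dimensions (vertex i))
  q i = proj₁ (proj₂ (local-dimensions (vertex i)))

  local : LocalIn p q
  local {i} {k} k≢p k≢q j
    rewrite isBounded-false {B (vertex i) k} (proj₂ (proj₂ (local-dimensions (vertex i))) k≢p k≢q) =
    whole-meets (B (vertex j) k)

  -- A colour for the isolated vertices with an empty box. One vertex is a clique, so r ≥ 1 and the
  -- palette is nonempty.
  fallback : Fin (n G) → Fin (palette r)
  fallback v = positive r (ω≤r 1 (λ _ → v)
    ((λ { {fzero} {fzero} _ → refl }) , λ { fzero fzero 0≢0 → contradiction refl 0≢0 }))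
    where
    positive : ∀ r → 1 ≤ r → Fin (palette r)
    positive (suc _) _ = fzero

  colouring : Σ (Fin (n G) → Fin (palette r)) (ProperColoring G (palette r))
  colouring = colour , proper
    where
    K = proj₁ (box-colouring clique≤r {p} {q} local)
    K≤ = proj₁ (proj₂ (box-colouring clique≤r {p} {q} local))
    c = proj₁ (proj₂ (proj₂ (box-colouring clique≤r {p} {q} local)))
    c-proper = proj₂ (proj₂ (proj₂ (box-colouring clique≤r {p} {q} local)))
    position : ∀ {v} → Nonempty v → Fin (length vertices)
    position {v} ne = index (∈-filter⁺ Nonempty? (∈-allFin v) ne)
    vertex-position : ∀ {v} (ne : Nonempty v) → v ≡ vertex (position ne)
    vertex-position {v} ne = lookup-index (∈-filter⁺ Nonempty? (∈-allFin v) ne)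
    colour : Fin (n G) → Fin (palette r)
    colour v with Nonempty? v
    ... | yes ne = inject≤ (c (position ne)) K≤
    ... | no  _  = fallback v
    proper : ProperColoring G (palette r) colour
    proper u v uv eq with Nonempty? u | Nonempty? v
    ... | no ¬ne | _      = ¬ne (Adj⇒Nonempty uv)
    ... | yes _  | no ¬ne = ¬ne (Adj⇒Nonempty (Graph.sym G uv))
    ... | yes ne | yes ne′ = c-proper position≢ intersect (Fin.inject≤-injective K≤ K≤ _ _ eq)
      where
      position≢ : position ne ≢ position ne′
      position≢ eq = irrefl G (subst (Adj G u)
        (trans (vertex-position ne′) (trans (cong vertex (sym eq)) (sym (vertex-position ne)))) uv)
      uv′ : Adj G (vertex (position ne)) (vertex (position ne′))
      uv′ = subst (λ v → Adj G _ v) (vertex-position ne′) (subst (λ u → Adj G u v) (vertex-position ne) uv)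
      intersect : Intersect (position ne) (position ne′)
      intersect k = Adj⇒lower≼upper uv′ k , Adj⇒lower≼upper (Graph.sym G uv′) k

theorem1p7 : (G : Graph) (r : ℕ) → LboxAtMost G 2 → CliqueNumber G r → ChiBound G r
theorem1p7 G r (d₀ , d₀≤2 , suc d , _ , _ , B , local , adj⇔) (_ , ω≤r) =
  palette r , proj₁ colouring , proj₂ colouring , 2^palette≤ r
  where open Colour G ω≤r B (λ v → ℕ.≤-trans (local v) d₀≤2) adj⇔
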